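{- For every integer $n\geqslant 0$, the number of partitions of $n$ with no parts equal to $1$ equals $\nabla[p](n)=p(n)-p(n-1)$, and $$\nabla [p](n) = -\sum_{k=3}^{n+3} S^{(3)}_{n+3,k}\, \mu(k).$$
   Context: $p(m)$ denotes the number of partitions of the integer $m$, with $p(0)=1$ and $p(m)=0$ for $m<0$. The $N$th order backward difference of a function $f$ is $\nabla^N[f](x)=\sum_{k=0}^N(-1)^k\binom{N}{k}f(x-k)$, and $\nabla=\nabla^1$. $\mu$ is the classical Möbius function on positive integers: $\mu(m)=0$ if $m$ is divisible by the square of a prime, and $\mu(m)=(-1)^s$ if $m$ is a product of $s\geqslant 0$ distinct primes. For integers $r\geqslant 1$, $k\geqslant 1$, $m\geqslant 0$, $S^{(r)}_{m,k}$ denotes the number of $k$'s in the partitions of $m$ with smallest part at least $r$, i.e. the total number of occurrences (with multiplicity) of the part $k$ summed over all partitions of $m$ all of whose parts are $\geqslant r$. -}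

module Defs where

open import Data.Bool using (if_then_else_)
open import Data.Integer as ℤ using (ℤ; +_; -[1+_]; 0ℤ; -1ℤ)
open import Data.List using (List; []; _∷_; map; foldr; filter; length; upTo; cartesianProductWith)
open import Data.List.Membership.Propositional using (_∈_; _∉_; lose; find)
open import Data.List.Membership.Propositional.Properties using (∈-filter⁺; ∈-filter⁻; ∈-cartesianProductWith⁺; ∈-cartesianProductWith⁻; ∈-upTo⁺)
open import Data.List.Properties using (∷-injective)
open import Data.List.Relation.Binary.Permutation.Propositional.Properties using (↭-length)
open import Data.List.Relation.Binary.Permutation.Propositional using (↭⇒↭ₛ)
open import Data.List.Relation.Binary.Permutation.Setoid.Properties using (Unique-resp-↭)
open import Data.List.Relation.Unary.All as All using (All; []; _∷_; all?)
open import Data.List.Relation.Unary.All.Properties using (¬Any⇒All¬)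
open import Data.List.Relation.Unary.AllPairs using ([]; _∷_)
open import Data.List.Relation.Unary.Any using (Any; here; there; any?)
open import Data.List.Relation.Unary.Linked using (Linked; linked?)
open import Data.List.Relation.Unary.Unique.Propositional using (Unique)
import Data.List.Relation.Unary.Unique.Propositional.Properties as Uniqueₚ
open import Data.Nat using (ℕ; zero; suc; _+_; _*_; _∸_; _≤_; _≥_; z≤n; s≤s; _≟_; _≤?_; _≥?_; NonZero)
open import Data.List.Membership.DecPropositional _≟_ public using (_∉?_)
open import Data.Nat.Combinatorics using (_C_)
open import Data.Nat.Divisibility using (_∣_; divides; _∣?_; ∣-trans; m∣m*n; ∣⇒≤)
open import Data.Nat.ListAction using (sum; product)
open import Data.Nat.Primality using (Prime; prime?; productOfPrimes≢0)
open import Data.Nat.Primality.Factorisation using (PrimeFactorisation; factors; factorise; factorisationUnique)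
open import Data.Nat.Properties using (≤-trans; m≤m+n; m≤n+m; +-mono-≤; *-comm; *-assoc; m*n≢0⇒m≢0)
open import Data.Product using (_×_; _,_; proj₂)
open import Function using (_∘_)
open import Function.Bundles using (_⇔_; mk⇔)
open import Relation.Binary.PropositionalEquality using (_≡_; refl; trans; cong; subst; setoid)
open import Relation.Nullary using (¬_; Dec; does)
open import Relation.Nullary.Decidable using (_×-dec_; dec-true; dec-false)

-- Empty when b < a.
sumFromTo : ℕ → ℕ → (ℕ → ℤ) → ℤ
sumFromTo a b f = foldr ℤ._+_ 0ℤ (map (λ i → f (a + i)) (upTo (suc b ∸ a)))

syntax sumFromTo a b (λ k → e) = ∑[ k ≔ a ⋯ b ] e

IsPartition : ℕ → List ℕ → Set
IsPartition m λs = Linked _≥_ λs × All (1 ≤_) λs × sum λs ≡ m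

isPartition? : ∀ m λs → Dec (IsPartition m λs)
isPartition? m λs = linked? _≥?_ λs ×-dec all? (1 ≤?_) λs ×-dec sum λs ≟ m

-- All lists of length at most l with entries at most b.
boundedLists : ℕ → ℕ → List (List ℕ)
boundedLists b zero    = [] ∷ []
boundedLists b (suc l) = [] ∷ cartesianProductWith _∷_ (upTo (suc b)) (boundedLists b l)

-- A partition of m has at most m parts, each at most m, so this lists every
-- partition of m exactly once (∈-partitions, partitions-unique).
partitions : ℕ → List (List ℕ)
partitions m = filter (isPartition? m) (boundedLists m m)

∈-boundedLists : ∀ {b l xs} → All (_≤ b) xs → length xs ≤ l → xs ∈ boundedLists b l
∈-boundedLists {l = zero}  []         _         = here refl
∈-boundedLists {l = suc l} []         _         = here refl
∈-boundedLists {l = suc l} (x≤ ∷ xs≤) (s≤s len) =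
  there (∈-cartesianProductWith⁺ _∷_ (∈-upTo⁺ (s≤s x≤)) (∈-boundedLists xs≤ len))

boundedLists-unique : ∀ b l → Unique (boundedLists b l)
boundedLists-unique b zero    = [] ∷ []
boundedLists-unique b (suc l) =
  ¬Any⇒All¬ _ []∉ ∷
  Uniqueₚ.cartesianProductWith⁺ _∷_ ∷-injective (Uniqueₚ.upTo⁺ (suc b)) (boundedLists-unique b l)
  where
  []∉ : [] ∉ cartesianProductWith _∷_ (upTo (suc b)) (boundedLists b l)
  []∉ []∈ with ∈-cartesianProductWith⁻ _∷_ (upTo (suc b)) (boundedLists b l) []∈
  ... | _ , _ , _ , _ , ()

parts≤sum : ∀ xs → All (_≤ sum xs) xs
parts≤sum []       = []
parts≤sum (x ∷ xs) = m≤m+n x (sum xs) ∷ All.map (λ y≤ → ≤-trans y≤ (m≤n+m (sum xs) x)) (parts≤sum xs)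

length≤sum : ∀ {xs} → All (1 ≤_) xs → length xs ≤ sum xs
length≤sum []         = z≤n
length≤sum (1≤x ∷ ps) = +-mono-≤ 1≤x (length≤sum ps)

∈-partitions : ∀ {m λs} → λs ∈ partitions m ⇔ IsPartition m λs
∈-partitions {m} {λs} = mk⇔ (proj₂ ∘ ∈-filter⁻ (isPartition? m) {xs = boundedLists m m}) complete
  where
  complete : IsPartition m λs → λs ∈ partitions m
  complete isP@(_ , pos , refl) =
    ∈-filter⁺ (isPartition? m) (∈-boundedLists (parts≤sum λs) (length≤sum pos)) isP

partitions-unique : ∀ m → Unique (partitions m)
partitions-unique m = Uniqueₚ.filter⁺ (isPartition? m) (boundedLists-unique m m)

p : ℤ → ℤ
p (+ m)    = + length (partitions m)
p -[1+ _ ] = 0ℤ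

∇^ : ℕ → (ℤ → ℤ) → ℤ → ℤ
∇^ N f x = ∑[ k ≔ 0 ⋯ N ] (-1ℤ ℤ.^ k ℤ.* + (N C k) ℤ.* f (x ℤ.- + k))

∇ : (ℤ → ℤ) → ℤ → ℤ
∇ = ∇^ 1

multiplicity : ℕ → List ℕ → ℕ
multiplicity k λs = length (filter (k ≟_) λs)

S : ℕ → ℕ → ℕ → ℕ
S r m k = sum (map (multiplicity k) (filter (all? (r ≤?_)) (partitions m)))

HasPrimeSquareDivisor : ℕ → Set
HasPrimeSquareDivisor m = Any (λ q → Prime q × q * q ∣ m) (upTo (suc m))

hasPrimeSquareDivisor? : ∀ m → Dec (HasPrimeSquareDivisor m)
hasPrimeSquareDivisor? m = any? (λ q → prime? q ×-dec q * q ∣? m) (upTo (suc m))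

-- The value at 0 is a placeholder. Where the exponent of -1 is used, m is
-- squarefree, so its prime factors are distinct (μ-square, μ-distinct).
μ : ℕ → ℤ
μ zero      = 0ℤ
μ m@(suc _) = if does (hasPrimeSquareDivisor? m) then 0ℤ else -1ℤ ℤ.^ length (factors (factorise m))

μ-square : ∀ {m q} → Prime q → q * q ∣ m → μ m ≡ 0ℤ
μ-square {zero}      pq q²∣m = refl
μ-square {m@(suc _)} {q} pq q²∣m
  rewrite dec-true (hasPrimeSquareDivisor? m)
            (lose (∈-upTo⁺ (s≤s (∣⇒≤ (∣-trans (m∣m*n q) q²∣m)))) (pq , q²∣m)) = refl

distinctPrimes⇒squarefree : ∀ {q ps} → All Prime ps → Unique ps → Prime q → ¬ (q * q ∣ product ps)
distinctPrimes⇒squarefree {q} {ps} pps ps! pq (divides c ps≡) =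
  repeated (Unique-resp-↭ (setoid ℕ) (↭⇒↭ₛ (factorisationUnique ps-factorisation qq-factorisation)) ps!)
  where
  repeated : ∀ {qs} → ¬ Unique (q ∷ q ∷ qs)
  repeated ((q≢q ∷ _) ∷ _) = q≢q refl

  instance
    c≢0 : NonZero c
    c≢0 = m*n≢0⇒m≢0 c {{subst NonZero ps≡ (productOfPrimes≢0 pps)}}

  c-factorisation : PrimeFactorisation c
  c-factorisation = factorise c

  ps-factorisation : PrimeFactorisation (product ps)
  ps-factorisation = record { factors = ps ; isFactorisation = refl ; factorsPrime = pps }

  qq-factorisation : PrimeFactorisation (product ps)
  qq-factorisation = record
    { factors         = q ∷ q ∷ factors c-factorisation
    ; isFactorisation = trans ps≡ (trans (*-comm c (q * q)) (trans (*-assoc q q c)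
        (cong (λ d → q * (q * d)) (PrimeFactorisation.isFactorisation c-factorisation))))
    ; factorsPrime    = pq ∷ pq ∷ PrimeFactorisation.factorsPrime c-factorisation
    }

μ-distinct : ∀ {m ps} → .{{NonZero m}} → All Prime ps → Unique ps → m ≡ product ps → μ m ≡ -1ℤ ℤ.^ length ps
μ-distinct {m@(suc _)} {ps} pps ps! m≡ =
  trans
    (cong (if_then 0ℤ else (-1ℤ ℤ.^ length (factors (factorise m)))) (dec-false (hasPrimeSquareDivisor? m) noSquare))
    (cong (-1ℤ ℤ.^_) (↭-length (factorisationUnique (factorise m) ps-factorisation)))
  where
  noSquare : ¬ HasPrimeSquareDivisor m
  noSquare h with find h
  ... | _ , _ , pq , q²∣m = distinctPrimes⇒squarefree pps ps! pq (subst (_ ∣_) m≡ q²∣m)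

  ps-factorisation : PrimeFactorisation m
  ps-factorisation = record { factors = ps ; isFactorisation = m≡ ; factorsPrime = pps }

{-# OPTIONS --safe #-}
-- Write P_r(m) for the number of partitions of m with all parts ≥ r. Removing one part k gives
-- S^{(r)}_{m,k} = Σ_{j≥1} P_r(m - jk), so Σ_{k≥3} S^{(3)}_{m,k} μ(k) = Σ_{d≥1} P_3(m - d) e(d) with
-- e(d) = Σ_{k∣d, k≥3} μ(k) = [d = 1] - 1 + [2 ∣ d]. Hence e(d) is -1 for odd d ≥ 3 and 0 otherwise, and
-- for m = n + 3 the sum is -Σ_{j≥0} P_3(n - 2j), which is -P_2(n) on sorting the partitions counted by
-- P_2(n) by their number j of 2's. Finally P_2(n) = p(n) - p(n - 1) by removing one part 1.
module Submission where

open import Data.Integer using (+_; 1ℤ; -_; _-_; _*_)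
open import Data.List using (filter; length)
open import Data.Nat using (ℕ; _+_)
open import Data.Product using (_×_)
open import Relation.Binary.PropositionalEquality using (_≡_)
open import Defs

open import Algebra.Bundles using (AbelianGroup)
open import Data.Bool using (true; false; if_then_else_)
open import Data.Integer as ℤ using (ℤ; 0ℤ; -1ℤ)
import Data.Integer.Properties as ℤₚ
open import Data.Integer.Tactic.RingSolver using (solve-∀)
open import Data.List using (List; []; _∷_; map; foldr; applyUpTo)
open import Data.List.Membership.DecPropositional Data.Nat._≟_ using (_∈?_)
open import Data.List.Membership.Propositional using (_∈_; _∉_; lose; find)
open import Data.List.Membership.Propositional.Properties using (∈-filter⁺; ∈-filter⁻; ∈-map⁺; ∈-map⁻; ∈-∃++; ∈-upTo⁺)
open import Data.List.Membership.Propositional.Properties.WithK using (unique∧set⇒bag)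
open import Data.List.Properties using (map-cong; map-∘; filter-none; filter-all; filter-accept)
open import Data.List.Relation.Binary.BagAndSetEquality using (∼bag⇒↭)
open import Data.List.Relation.Binary.Equality.Propositional using (≋⇒≡)
open import Data.List.Relation.Binary.Permutation.Propositional using (_↭_; ↭⇒↭ₛ; ↭-sym; ↭-trans; ↭-reflexive; prep)
open import Data.List.Relation.Binary.Permutation.Propositional.Properties
  using (All-resp-↭; ∈-resp-↭; drop-∷; filter-↭; map⁺; shift; ↭-length)
open import Data.List.Relation.Unary.All as All using (All; []; _∷_; all?)
import Data.List.Relation.Unary.All.Properties as Allₚ
open import Data.List.Relation.Unary.AllPairs using ([]; _∷_)
open import Data.List.Relation.Unary.Any using (here; there)
open import Data.List.Relation.Unary.Linked using (Linked)
open import Data.List.Relation.Unary.Sorted.TotalOrder.Properties using (↗↭↗⇒≋)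
open import Data.List.Relation.Unary.Unique.Propositional using (Unique)
import Data.List.Relation.Unary.Unique.Propositional.Properties as Uniqueₚ
import Data.List.Sort.InsertionSort.Base as InsertionSort
import Data.List.Sort.InsertionSort.Properties as InsertionSortₚ
open import Data.Nat as ℕ using (zero; suc; _∸_; _≤_; _<_; _≥_; _≤?_; _≟_; s≤s; z<s; s<s)
open import Data.Nat.Divisibility
  using (_∣_; _∣?_; divides; _∣0; 1∣_; ∣-refl; ∣-trans; ∣⇒≤; m∣m*n; m*n∣⇒m∣; *-monoˡ-∣; *-cancelʳ-∣; ∣m∣n⇒∣m+n; ∣m+n∣m⇒∣n)
open import Data.Nat.Induction using (<-rec)
open import Data.Nat.ListAction using (sum)
open import Data.Nat.ListAction.Properties using (sum-↭)
open import Data.Nat.Primality using (Prime; euclidsLemma; prime⇒nonZero; prime⇒irreducible; ¬prime[1])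
open import Data.Nat.Primality.Factorisation using (PrimeFactorisation; factors; factorise; factorisationUnique)
import Data.Nat.Properties as ℕₚ
open import Algebra.Properties.CommutativeSemigroup ℕₚ.+-commutativeSemigroup using (x∙yz≈y∙xz)
open import Algebra.Properties.Group (AbelianGroup.group ℤₚ.+-0-abelianGroup) using (∙-cancelʳ)
open import Data.Product using (∃-syntax; _,_; proj₁; proj₂)
open import Data.Sum using (inj₁; inj₂)
open import Function using (_∘_; _$_)
open import Function.Bundles using (_⇔_; mk⇔; Equivalence)
open import Relation.Binary using (DecTotalOrder)
import Relation.Binary.Construct.Flip.EqAndOrd as Flip
open import Relation.Binary.PropositionalEquality
  using (refl; sym; trans; cong; cong₂; subst; module ≡-Reasoning)
open import Relation.Nullary using (¬_; Dec; does; yes; no; contradiction)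
open import Relation.Nullary.Decidable using (¬?; dec-true; dec-false; does-⇔)
open import Relation.Unary using (Pred; Decidable)

private variable
  d k m n q r : ℕ
  xs ys : List ℕ

-- Partitions with a lower bound on the parts

≥-decTotalOrder : DecTotalOrder _ _ _
≥-decTotalOrder = Flip.decTotalOrder ℕₚ.≤-decTotalOrder

open InsertionSort ≥-decTotalOrder using (insert; sort)
open InsertionSortₚ ≥-decTotalOrder using (insert-↭; insert-↗; sort-↭; sort-↗)

-- A partition is determined by the multiset of its parts, so equality of partitions can be checked
-- up to permutation.
unique-sorted : Linked _≥_ xs → Linked _≥_ ys → xs ↭ ys → xs ≡ ys
unique-sorted xs↘ ys↘ xs↭ys =
  ≋⇒≡ (↗↭↗⇒≋ (DecTotalOrder.totalOrder ≥-decTotalOrder) xs↘ ys↘ (↭⇒↭ₛ xs↭ys))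

∈⇒↭∷ : k ∈ xs → ∃[ ys ] xs ↭ k ∷ ys
∈⇒↭∷ k∈xs with ∈-∃++ k∈xs
... | ys , zs , refl = _ , shift _ ys zs

-- Opaque so that r and m can be inferred from partitionsFrom r m.
opaque
  partitionsFrom : ℕ → ℕ → List (List ℕ)
  partitionsFrom r m = filter (all? (r ≤?_)) (partitions m)

  partitionsFrom-unique : ∀ r m → Unique (partitionsFrom r m)
  partitionsFrom-unique r m = Uniqueₚ.filter⁺ (all? (r ≤?_)) (partitions-unique m)

  ∈-partitionsFrom⁺ : IsPartition m xs → All (r ≤_) xs → xs ∈ partitionsFrom r m
  ∈-partitionsFrom⁺ isP = ∈-filter⁺ (all? _) (Equivalence.from ∈-partitions isP)

  ∈-partitionsFrom⁻ : xs ∈ partitionsFrom r m → IsPartition m xs × All (r ≤_) xs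
  ∈-partitionsFrom⁻ {r = r} {m = m} xs∈ with ∈-filter⁻ (all? (r ≤?_)) {xs = partitions m} xs∈
  ... | xs∈ , r≤ = Equivalence.to ∈-partitions xs∈ , r≤

  S-partitionsFrom : S r m k ≡ sum (map (multiplicity k) (partitionsFrom r m))
  S-partitionsFrom = refl

  partitionsFrom-1 : ∀ m → partitionsFrom 1 m ≡ partitions m
  partitionsFrom-1 m = filter-all (all? (1 ≤?_))
    (All.tabulate λ xs∈ → proj₁ (proj₂ (Equivalence.to (∈-partitions {m}) xs∈)))

unique∧set⇒↭ : ∀ {a} {A : Set a} {xs ys : List A} → Unique xs → Unique ys →
  (∀ {x} → x ∈ xs → x ∈ ys) → (∀ {x} → x ∈ ys → x ∈ xs) → xs ↭ ys
unique∧set⇒↭ xs! ys! to from = ∼bag⇒↭ (unique∧set⇒bag xs! ys! (mk⇔ to from))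

-- Injectivity is asked only on members of `xs`, so that it may be checked knowing that both
-- arguments are partitions.
map-unique : ∀ {a b} {A : Set a} {B : Set b} {f : A → B} {xs : List A} →
  (∀ {x y} → x ∈ xs → y ∈ xs → f x ≡ f y → x ≡ y) → Unique xs → Unique (map f xs)
map-unique inj []          = []
map-unique inj (x∉ ∷ xs!) =
  Allₚ.map⁺ (All.tabulate λ y∈ fx≡fy → All.lookup x∉ y∈ (inj (here refl) (there y∈) fx≡fy))
  ∷ map-unique (λ x∈ y∈ → inj (there x∈) (there y∈)) xs!

-- Inserting a part `k` and removing one copy of it are inverse to each other. Both lists are free
-- of repetitions, so it suffices that they have the same members.
withPart↭insert : 1 ≤ k → r ≤ k →
  filter (k ∈?_) (partitionsFrom r (k + m)) ↭ map (insert k) (partitionsFrom r m)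
withPart↭insert {k} {r} {m} 1≤k r≤k = unique∧set⇒↭
  (Uniqueₚ.filter⁺ (k ∈?_) (partitionsFrom-unique r (k + m)))
  (map-unique insert-injective (partitionsFrom-unique r m))
  to from
  where
  insert-injective : xs ∈ partitionsFrom r m → ys ∈ partitionsFrom r m → insert k xs ≡ insert k ys → xs ≡ ys
  insert-injective {xs} {ys} xs∈ ys∈ eq
    with (xs↘ , _) , _ ← ∈-partitionsFrom⁻ xs∈ | (ys↘ , _) , _ ← ∈-partitionsFrom⁻ ys∈ =
    unique-sorted xs↘ ys↘
      (drop-∷ (↭-trans (↭-sym (insert-↭ k xs)) (↭-trans (↭-reflexive eq) (insert-↭ k ys))))

  to : xs ∈ filter (k ∈?_) (partitionsFrom r (k + m)) → xs ∈ map (insert k) (partitionsFrom r m)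
  to {xs} xs∈
    with xs∈ , k∈xs ← ∈-filter⁻ (k ∈?_) {xs = partitionsFrom r (k + m)} xs∈
    with (xs↘ , pos , sum≡) , r≤ ← ∈-partitionsFrom⁻ xs∈
    with ys , xs↭k∷ys ← ∈⇒↭∷ k∈xs
    -- The remainder left after extracting `k` comes in no known order; sorting it turns it into a
    -- partition.
    with xs↭k∷ys ← ↭-trans xs↭k∷ys (prep k (↭-sym (sort-↭ ys)))
    with _ ∷ pos′ ← All-resp-↭ xs↭k∷ys pos | _ ∷ r≤′ ← All-resp-↭ xs↭k∷ys r≤ =
    subst (_∈ map (insert k) (partitionsFrom r m))
      (unique-sorted (insert-↗ k (sort-↗ ys)) xs↘ (↭-trans (insert-↭ k (sort ys)) (↭-sym xs↭k∷ys)))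
      (∈-map⁺ (insert k) (∈-partitionsFrom⁺
        (sort-↗ ys , pos′ , ℕₚ.+-cancelˡ-≡ k _ _ (trans (sym (sum-↭ xs↭k∷ys)) sum≡)) r≤′))

  from : xs ∈ map (insert k) (partitionsFrom r m) → xs ∈ filter (k ∈?_) (partitionsFrom r (k + m))
  from xs∈
    with ys , ys∈ , refl ← ∈-map⁻ (insert k) xs∈
    with (ys↘ , pos , sum≡) , r≤ ← ∈-partitionsFrom⁻ ys∈ =
    ∈-filter⁺ (k ∈?_)
      (∈-partitionsFrom⁺
        ( insert-↗ k ys↘
        , All-resp-↭ k∷ys↭ (1≤k ∷ pos)
        , trans (sum-↭ (insert-↭ k ys)) (cong (k ℕ.+_) sum≡))
        (All-resp-↭ k∷ys↭ (r≤k ∷ r≤)))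
      (∈-resp-↭ k∷ys↭ (here refl))
    where k∷ys↭ = ↭-sym (insert-↭ k ys)

-- When all parts are at least `r`, avoiding `r` is the same as having all parts at least `suc r`.
withoutPart↭ : filter (¬? ∘ (r ∈?_)) (partitionsFrom r m) ↭ partitionsFrom (suc r) m
withoutPart↭ {r} {m} = unique∧set⇒↭
  (Uniqueₚ.filter⁺ _ (partitionsFrom-unique r m)) (partitionsFrom-unique (suc r) m) to from
  where
  to : xs ∈ filter (¬? ∘ (r ∈?_)) (partitionsFrom r m) → xs ∈ partitionsFrom (suc r) m
  to xs∈
    with xs∈ , r∉xs ← ∈-filter⁻ (¬? ∘ (r ∈?_)) {xs = partitionsFrom r m} xs∈
    with isP , r≤ ← ∈-partitionsFrom⁻ xs∈ =
    ∈-partitionsFrom⁺ isP (All.zipWith (λ (r≤x , r≢x) → ℕₚ.≤∧≢⇒< r≤x r≢x) (r≤ , Allₚ.¬Any⇒All¬ _ r∉xs))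

  from : xs ∈ partitionsFrom (suc r) m → xs ∈ filter (¬? ∘ (r ∈?_)) (partitionsFrom r m)
  from xs∈ with isP , r< ← ∈-partitionsFrom⁻ xs∈ =
    ∈-filter⁺ _ (∈-partitionsFrom⁺ isP (All.map ℕₚ.<⇒≤ r<)) λ r∈ → ℕₚ.<-irrefl refl (All.lookup r< r∈)

sum-map-filter : ∀ {a p} {A : Set a} {P : Pred A p} (P? : Decidable P) (f : A → ℕ) xs →
  sum (map f xs) ≡ sum (map f (filter P? xs)) + sum (map f (filter (¬? ∘ P?) xs))
sum-map-filter P? f []       = refl
sum-map-filter P? f (x ∷ xs) with P? x
... | yes _ = trans (cong (f x ℕ.+_) (sum-map-filter P? f xs)) (sym (ℕₚ.+-assoc (f x) _ _))
... | no  _ = trans (cong (f x ℕ.+_) (sum-map-filter P? f xs)) (x∙yz≈y∙xz (f x) (sum (map f (filter P? xs))) _)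

length≡sum-1 : ∀ {a} {A : Set a} (xs : List A) → length xs ≡ sum (map (λ _ → 1) xs)
length≡sum-1 []       = refl
length≡sum-1 (x ∷ xs) = cong suc (length≡sum-1 xs)

sum-map-suc : ∀ {a} {A : Set a} (f : A → ℕ) xs → sum (map (suc ∘ f) xs) ≡ length xs + sum (map f xs)
sum-map-suc f []       = refl
sum-map-suc f (x ∷ xs) =
  cong suc (trans (cong (f x ℕ.+_) (sum-map-suc f xs)) (x∙yz≈y∙xz (f x) (length xs) _))

sum-map-zero : ∀ {a} {A : Set a} {f : A → ℕ} {xs} → All (λ x → f x ≡ 0) xs → sum (map f xs) ≡ 0
sum-map-zero []           = refl
sum-map-zero (fx≡0 ∷ fxs) rewrite fx≡0 = sum-map-zero fxs

multiplicity-insert : ∀ k xs → multiplicity k (insert k xs) ≡ suc (multiplicity k xs)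
multiplicity-insert k xs = trans
  (↭-length (filter-↭ (k ≟_) (insert-↭ k xs)))
  (cong length (filter-accept (k ≟_) refl))

multiplicity-∉ : k ∉ xs → multiplicity k xs ≡ 0
multiplicity-∉ k∉xs = cong length (filter-none (_ ≟_) (Allₚ.¬Any⇒All¬ _ k∉xs))

-- No part exceeds the sum of all parts.
∉-partitionsFrom : m < k → All (k ∉_) (partitionsFrom r m)
∉-partitionsFrom m<k = All.tabulate λ xs∈ k∈xs →
  let (_ , _ , sum≡) , _ = ∈-partitionsFrom⁻ xs∈
  in ℕₚ.<⇒≱ m<k (subst (_ ≤_) sum≡ (All.lookup (parts≤sum _) k∈xs))

-- Recurrences for partition counts and part counts

#partitionsFrom : ℕ → ℕ → ℕ
#partitionsFrom r m = length (partitionsFrom r m)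

#withoutPart : length (filter (¬? ∘ (r ∈?_)) (partitionsFrom r m)) ≡ #partitionsFrom (suc r) m
#withoutPart = ↭-length withoutPart↭

#partitionsFrom-< : m < r → #partitionsFrom r m ≡ #partitionsFrom (suc r) m
#partitionsFrom-< {m} {r} m<r = trans
  (cong length (sym (filter-all (¬? ∘ (r ∈?_)) (∉-partitionsFrom m<r)))) #withoutPart

sum-map-↭ : ∀ {a} {A : Set a} (f : A → ℕ) {xs ys} → xs ↭ ys → sum (map f xs) ≡ sum (map f ys)
sum-map-↭ f = sum-↭ ∘ map⁺ f

-- Splits by whether `k` occurs and carries the first half over the insertion bijection. The weight
-- `f` is general: a constant 1 gives counts, `multiplicity k` gives `S`.
sum-partitionsFrom : 1 ≤ k → r ≤ k → (f : List ℕ → ℕ) →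
  sum (map f (partitionsFrom r (k + m)))
    ≡ sum (map (f ∘ insert k) (partitionsFrom r m)) + sum (map f (filter (¬? ∘ (k ∈?_)) (partitionsFrom r (k + m))))
sum-partitionsFrom {k} {r} {m} 1≤k r≤k f = trans
  (sum-map-filter (k ∈?_) f (partitionsFrom r (k + m)))
  (cong (λ s → s + sum (map f (filter (¬? ∘ (k ∈?_)) (partitionsFrom r (k + m)))))
    (trans (sum-map-↭ f (withPart↭insert 1≤k r≤k)) (cong sum (sym (map-∘ (partitionsFrom r m))))))

#partitionsFrom-+ : 1 ≤ r → #partitionsFrom r (r + m) ≡ #partitionsFrom r m + #partitionsFrom (suc r) (r + m)
#partitionsFrom-+ {r} {m} 1≤r = begin
  #partitionsFrom r (r + m)
    ≡⟨ length≡sum-1 (partitionsFrom r (r + m)) ⟩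
  sum (map (λ _ → 1) (partitionsFrom r (r + m)))
    ≡⟨ sum-partitionsFrom 1≤r ℕₚ.≤-refl (λ _ → 1) ⟩
  sum (map (λ _ → 1) (partitionsFrom r m)) + sum (map (λ _ → 1) (filter (¬? ∘ (r ∈?_)) (partitionsFrom r (r + m))))
    ≡⟨ cong₂ _+_ (length≡sum-1 (partitionsFrom r m)) (length≡sum-1 (filter (¬? ∘ (r ∈?_)) (partitionsFrom r (r + m)))) ⟨
  #partitionsFrom r m + length (filter (¬? ∘ (r ∈?_)) (partitionsFrom r (r + m)))
    ≡⟨ cong (#partitionsFrom r m ℕ.+_) #withoutPart ⟩
  #partitionsFrom r m + #partitionsFrom (suc r) (r + m) ∎
  where open ≡-Reasoning

-- Base values for the recurrence `S-+`: a partition of `m` has no part exceeding `m`.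
S-< : m < k → S r m k ≡ 0
S-< m<k = trans S-partitionsFrom (sum-map-zero (All.map multiplicity-∉ (∉-partitionsFrom m<k)))

-- Insertion adds one copy of `k` to each partition of `m`, whence the extra count; partitions
-- without `k` contribute nothing.
S-+ : 1 ≤ k → r ≤ k → S r (k + m) k ≡ #partitionsFrom r m + S r m k
S-+ {k} {r} {m} 1≤k r≤k = begin
  S r (k + m) k
    ≡⟨ S-partitionsFrom ⟩
  sum (map (multiplicity k) (partitionsFrom r (k + m)))
    ≡⟨ sum-partitionsFrom 1≤k r≤k (multiplicity k) ⟩
  sum (map (multiplicity k ∘ insert k) (partitionsFrom r m))
    + sum (map (multiplicity k) (filter (¬? ∘ (k ∈?_)) (partitionsFrom r (k + m))))
    ≡⟨ cong₂ _+_ (cong sum (map-cong (multiplicity-insert k) (partitionsFrom r m)))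
         (sum-map-zero (All.map multiplicity-∉ (Allₚ.all-filter (¬? ∘ (k ∈?_)) (partitionsFrom r (k + m))))) ⟩
  sum (map (suc ∘ multiplicity k) (partitionsFrom r m)) + 0
    ≡⟨ ℕₚ.+-identityʳ _ ⟩
  sum (map (suc ∘ multiplicity k) (partitionsFrom r m))
    ≡⟨ sum-map-suc (multiplicity k) (partitionsFrom r m) ⟩
  #partitionsFrom r m + sum (map (multiplicity k) (partitionsFrom r m))
    ≡⟨ cong (#partitionsFrom r m ℕ.+_) S-partitionsFrom ⟨
  #partitionsFrom r m + S r m k ∎
  where open ≡-Reasoning

-- All parts are at least 1, so this is the passage from bound 1 to bound 2.
filter-1∉ : ∀ n → length (filter (λ λs → 1 ∉? λs) (partitions n)) ≡ #partitionsFrom 2 n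
filter-1∉ n = trans
  (cong (length ∘ filter (λ λs → 1 ∉? λs)) (sym (partitionsFrom-1 n)))
  #withoutPart

-- Finite sums

-- The Iverson bracket. It turns divisibility conditions into factors, so that every sum runs over a
-- plain interval and sums can be interchanged.
⟦_⟧ : ∀ {A : Set} → Dec A → ℤ
⟦ a? ⟧ = if does a? then 1ℤ else 0ℤ

⟦⟧-true : ∀ {A : Set} (a? : Dec A) → A → ⟦ a? ⟧ ≡ 1ℤ
⟦⟧-true a? x = cong (if_then 1ℤ else 0ℤ) (dec-true a? x)

⟦⟧-false : ∀ {A : Set} (a? : Dec A) → ¬ A → ⟦ a? ⟧ ≡ 0ℤ
⟦⟧-false a? x = cong (if_then 1ℤ else 0ℤ) (dec-false a? x)

⟦⟧-⇔ : ∀ {A B : Set} (a? : Dec A) (b? : Dec B) → A ⇔ B → ⟦ a? ⟧ ≡ ⟦ b? ⟧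
⟦⟧-⇔ a? b? eq = cong (if_then 1ℤ else 0ℤ) (does-⇔ eq a? b?)

∑ : ℕ → (ℕ → ℤ) → ℤ
∑ zero    f = 0ℤ
∑ (suc n) f = f 0 ℤ.+ ∑ n (f ∘ suc)

∑-cong : ∀ {f g : ℕ → ℤ} n → (∀ i → i < n → f i ≡ g i) → ∑ n f ≡ ∑ n g
∑-cong zero    eq = refl
∑-cong (suc n) eq = cong₂ ℤ._+_ (eq 0 z<s) (∑-cong n λ i i<n → eq (suc i) (s<s i<n))

∑-zero : ∀ {f : ℕ → ℤ} n → (∀ i → i < n → f i ≡ 0ℤ) → ∑ n f ≡ 0ℤ
∑-zero zero    eq = refl
∑-zero (suc n) eq = cong₂ ℤ._+_ (eq 0 z<s) (∑-zero n λ i i<n → eq (suc i) (s<s i<n))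

∑-split : ∀ m n (f : ℕ → ℤ) → ∑ (m + n) f ≡ ∑ m f ℤ.+ ∑ n (λ i → f (m + i))
∑-split zero    n f = sym (ℤₚ.+-identityˡ _)
∑-split (suc m) n f =
  trans (cong (λ x → f 0 ℤ.+ x) (∑-split m n (f ∘ suc))) (sym (ℤₚ.+-assoc (f 0) _ _))

∑-last : ∀ n (f : ℕ → ℤ) → ∑ (suc n) f ≡ ∑ n f ℤ.+ f n
∑-last zero    f = ℤₚ.+-comm (f 0) 0ℤ
∑-last (suc n) f =
  trans (cong (λ x → f 0 ℤ.+ x) (∑-last n (f ∘ suc))) (sym (ℤₚ.+-assoc (f 0) _ _))

∑-extend : ∀ {m n} {f : ℕ → ℤ} → m ≤ n → (∀ i → m ≤ i → f i ≡ 0ℤ) → ∑ n f ≡ ∑ m f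
∑-extend {m} {n} {f} m≤n eq = begin
  ∑ n f                                    ≡⟨ cong (λ n → ∑ n f) (ℕₚ.m+[n∸m]≡n m≤n) ⟨
  ∑ (m + (n ∸ m)) f                        ≡⟨ ∑-split m (n ∸ m) f ⟩
  ∑ m f ℤ.+ ∑ (n ∸ m) (λ i → f (m + i))    ≡⟨ cong (λ x → ∑ m f ℤ.+ x) (∑-zero (n ∸ m) λ i _ → eq (m + i) (ℕₚ.m≤m+n m i)) ⟩
  ∑ m f ℤ.+ 0ℤ                             ≡⟨ ℤₚ.+-identityʳ _ ⟩
  ∑ m f ∎
  where open ≡-Reasoning

∑-distrib-+ : ∀ n (f g : ℕ → ℤ) → ∑ n (λ i → f i ℤ.+ g i) ≡ ∑ n f ℤ.+ ∑ n g
∑-distrib-+ zero    f g = refl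
∑-distrib-+ (suc n) f g =
  trans (cong (λ x → f 0 ℤ.+ g 0 ℤ.+ x) (∑-distrib-+ n (f ∘ suc) (g ∘ suc)))
    (lemma (f 0) (g 0) _ _)
  where
  lemma : ∀ a b c d → a ℤ.+ b ℤ.+ (c ℤ.+ d) ≡ a ℤ.+ c ℤ.+ (b ℤ.+ d)
  lemma = solve-∀

*-distribˡ-∑ : ∀ n c (f : ℕ → ℤ) → c * ∑ n f ≡ ∑ n (λ i → c * f i)
*-distribˡ-∑ zero    c f = ℤₚ.*-zeroʳ c
*-distribˡ-∑ (suc n) c f =
  trans (ℤₚ.*-distribˡ-+ c (f 0) _) (cong (λ x → c * f 0 ℤ.+ x) (*-distribˡ-∑ n c (f ∘ suc)))

neg-∑ : ∀ n (f : ℕ → ℤ) → ∑ n (λ i → - f i) ≡ - ∑ n f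
neg-∑ zero    f = refl
neg-∑ (suc n) f = trans (cong (λ x → - f 0 ℤ.+ x) (neg-∑ n (f ∘ suc))) (sym (ℤₚ.neg-distrib-+ (f 0) _))

∑-comm : ∀ m n (f : ℕ → ℕ → ℤ) → ∑ m (λ i → ∑ n (f i)) ≡ ∑ n (λ j → ∑ m (λ i → f i j))
∑-comm zero    n f = sym (∑-zero n λ _ _ → refl)
∑-comm (suc m) n f =
  trans (cong (λ x → ∑ n (f 0) ℤ.+ x) (∑-comm m n (f ∘ suc))) (sym (∑-distrib-+ n (f 0) _))

∑-foldr : ∀ n (f : ℕ → ℤ) (g : ℕ → ℕ) → foldr ℤ._+_ 0ℤ (map f (applyUpTo g n)) ≡ ∑ n (f ∘ g)
∑-foldr zero    f g = refl
∑-foldr (suc n) f g = cong (λ x → f (g 0) ℤ.+ x) (∑-foldr n f (g ∘ suc))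

-- Cut the range into `n` blocks of length `q`; the only multiple of `q` in each block is its first
-- index.
∑-multiples : ∀ q .{{_ : ℕ.NonZero q}} n (f : ℕ → ℤ) →
  ∑ (n ℕ.* q) (λ i → ⟦ q ∣? i ⟧ * f i) ≡ ∑ n (λ j → f (j ℕ.* q))
∑-multiples q zero f = refl
∑-multiples q@(suc q-1) (suc n) f = trans
  (∑-split q (n ℕ.* q) (λ i → ⟦ q ∣? i ⟧ * f i))
  (cong₂ ℤ._+_
    (trans
      (cong₂ ℤ._+_ (trans (cong (λ x → x * f 0) (⟦⟧-true (q ∣? 0) (q ∣0))) (ℤₚ.*-identityˡ (f 0)))
         -- The indices 1 to `q-1` of the first block are positive and below `q`.
         (∑-zero q-1 λ i i<q-1 →
           trans (cong (λ x → x * f (suc i)) (⟦⟧-false (q ∣? suc i) λ q∣ → ℕₚ.<⇒≱ (s≤s i<q-1) (∣⇒≤ q∣)))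
             (ℤₚ.*-zeroˡ (f (suc i)))))
      (ℤₚ.+-identityʳ (f 0)))
    (trans
      -- Shifting by `q` preserves divisibility by `q`, so the remaining blocks fall to the
      -- induction.
      (∑-cong (n ℕ.* q) λ i _ →
        cong (λ x → x * f (q + i)) (⟦⟧-⇔ (q ∣? q + i) (q ∣? i)
          (mk⇔ (λ q∣ → ∣m+n∣m⇒∣n q∣ ∣-refl) (∣m∣n⇒∣m+n ∣-refl))))
      (∑-multiples q n (λ i → f (q + i)))))

-- The Möbius function

-- Such a `q` is at most `m`, hence inside the bounded search range of `HasPrimeSquareDivisor`.
squareDivisor : .{{ℕ.NonZero m}} → Prime q → q ℕ.* q ∣ m → HasPrimeSquareDivisor m
squareDivisor {q = q} pq q²∣m = lose (∈-upTo⁺ (s≤s (∣⇒≤ (∣-trans (m∣m*n q) q²∣m)))) (pq , q²∣m)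

μ-squarefree : ∀ m .{{_ : ℕ.NonZero m}} → ¬ HasPrimeSquareDivisor m → μ m ≡ -1ℤ ℤ.^ length (factors (factorise m))
μ-squarefree m@(suc _) sf =
  cong (if_then 0ℤ else (-1ℤ ℤ.^ length (factors (factorise m)))) (dec-false (hasPrimeSquareDivisor? m) sf)

prime∣prime⇒≡ : Prime q → Prime r → q ∣ r → q ≡ r
prime∣prime⇒≡ pq pr q∣r with prime⇒irreducible pr q∣r
... | inj₁ refl = contradiction pq ¬prime[1]
... | inj₂ eq   = eq

-- If `r` equals `q`, cancelling one factor gives `q ∣ m`, which is excluded. Otherwise Euclid's
-- lemma, used twice, moves both factors `r` into `m`.
prime-square∣* : Prime q → Prime r → ¬ q ∣ m → r ℕ.* r ∣ m ℕ.* q → r ℕ.* r ∣ m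
prime-square∣* {q} {r} {m} pq pr q∤m r²∣mq with r ℕ.≟ q
... | yes refl = contradiction (*-cancelʳ-∣ r {{prime⇒nonZero pr}} r²∣mq) q∤m
... | no r≢q   with euclidsLemma m q pr (∣-trans (m∣m*n r) r²∣mq)
...   | inj₂ r∣q = contradiction (prime∣prime⇒≡ pr pq r∣q) r≢q
...   | inj₁ (divides c refl)
        with euclidsLemma c q pr (*-cancelʳ-∣ r {{prime⇒nonZero pr}} (subst (r ℕ.* r ∣_) swap r²∣mq))
        where
        swap : c ℕ.* r ℕ.* q ≡ c ℕ.* q ℕ.* r
        swap = trans (ℕₚ.*-assoc c r q) (trans (cong (c ℕ.*_) (ℕₚ.*-comm r q)) (sym (ℕₚ.*-assoc c q r)))
...     | inj₁ r∣c = *-monoˡ-∣ r r∣c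
...     | inj₂ r∣q = contradiction (prime∣prime⇒≡ pr pq r∣q) r≢q

-- A square divisor of `m` makes both sides 0. If `m` is squarefree, so is `m ℕ.* q`, and its one
-- additional prime factor flips the sign.
μ-*-prime : Prime q → ¬ q ∣ m → μ (m ℕ.* q) ≡ - μ m
μ-*-prime {q} {zero}      pq q∤m = refl
μ-*-prime {q} {m@(suc _)} pq q∤m = μ-lemma (hasPrimeSquareDivisor? m)
  where
  open ≡-Reasoning
  instance
    mq≢0 : ℕ.NonZero (m ℕ.* q)
    mq≢0 = ℕₚ.m*n≢0 m q {{_}} {{prime⇒nonZero pq}}

  noSquare : ¬ HasPrimeSquareDivisor m → ¬ HasPrimeSquareDivisor (m ℕ.* q)
  noSquare sf h with find h
  ... | _ , _ , pr , r²∣mq = sf (squareDivisor pr (prime-square∣* pq pr q∤m r²∣mq))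

  mq-factorisation : PrimeFactorisation (m ℕ.* q)
  mq-factorisation = record
    { factors         = q ∷ factors (factorise m)
    ; isFactorisation = trans (ℕₚ.*-comm m q) (cong (q ℕ.*_) (PrimeFactorisation.isFactorisation (factorise m)))
    ; factorsPrime    = pq ∷ PrimeFactorisation.factorsPrime (factorise m)
    }

  μ-lemma : Dec (HasPrimeSquareDivisor m) → μ (m ℕ.* q) ≡ - μ m
  μ-lemma (yes h) with find h
  ... | _ , _ , pr , r²∣m = trans (μ-square pr (∣-trans r²∣m (m∣m*n q))) (cong -_ (sym (μ-square pr r²∣m)))
  μ-lemma (no sf) = begin
    μ (m ℕ.* q)                                    ≡⟨ μ-squarefree (m ℕ.* q) (noSquare sf) ⟩
    -1ℤ ℤ.^ length (factors (factorise (m ℕ.* q))) ≡⟨ cong (-1ℤ ℤ.^_)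
                                                        (↭-length (factorisationUnique (factorise (m ℕ.* q)) mq-factorisation)) ⟩
    -1ℤ * (-1ℤ ℤ.^ length (factors (factorise m))) ≡⟨ ℤₚ.-1*i≡-i _ ⟩
    - (-1ℤ ℤ.^ length (factors (factorise m)))     ≡⟨ cong -_ (μ-squarefree m sf) ⟨
    - μ m ∎

primeDivisor : ∀ d → .{{_ : ℕ.NonTrivial d}} → ∃[ q ] Prime q × q ∣ d
primeDivisor d@(suc (suc _)) with factorise d
-- The empty factorisation has product 1, which `d` is not.
... | record { factors = q ∷ qs ; isFactorisation = d≡ ; factorsPrime = pq ∷ _ } =
  q , pq , subst (q ∣_) (sym d≡) (m∣m*n _)

-- Write `d` as `c` times `k`; since `q` does not divide `k`, it divides the cofactor `c`.
*-∣-prime : Prime q → q ∣ d → ¬ q ∣ k → k ∣ d → k ℕ.* q ∣ d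
*-∣-prime {q} {k = k} pq q∣d q∤k (divides c refl) with euclidsLemma c k pq q∣d
... | inj₁ (divides b refl) = divides b (trans (ℕₚ.*-assoc b q k) (cong (b ℕ.*_) (ℕₚ.*-comm q k)))
... | inj₂ q∣k              = contradiction q∣k q∤k

-- For a prime q ∣ d, the squarefree divisors of d pair off as k ↔ k q with q ∤ k, and μ (k q) = - μ k.
∑∣μ≡0 : .{{_ : ℕ.NonTrivial d}} → d < n → ∑ n (λ k → ⟦ k ∣? d ⟧ * μ k) ≡ 0ℤ
∑∣μ≡0 {d} {n} d<n with q , pq , q∣d ← primeDivisor d = begin
  ∑ n F                                          ≡⟨ ∑-extend d<n (λ k → F-zero) ⟩
  ∑ (suc d) F                                    ≡⟨ ∑-extend d<N (λ k → F-zero) ⟨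
  ∑ N F                                          ≡⟨ ∑-cong N (λ k _ → F-split k) ⟩
  ∑ N (λ k → G k ℤ.+ ⟦ q ∣? k ⟧ * F k)           ≡⟨ ∑-distrib-+ N G _ ⟩
  ∑ N G ℤ.+ ∑ N (λ k → ⟦ q ∣? k ⟧ * F k)         ≡⟨ cong₂ ℤ._+_ (∑-extend d<N (λ k → G-zero k)) (∑-multiples q (suc d) F) ⟩
  ∑ (suc d) G ℤ.+ ∑ (suc d) (λ k → F (k ℕ.* q))  ≡⟨ cong (λ x → ∑ (suc d) G ℤ.+ x) (∑-cong (suc d) (λ k _ → F-*q k)) ⟩
  ∑ (suc d) G ℤ.+ ∑ (suc d) (λ k → - G k)        ≡⟨ cong (λ x → ∑ (suc d) G ℤ.+ x) (neg-∑ (suc d) G) ⟩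
  ∑ (suc d) G ℤ.+ - ∑ (suc d) G                  ≡⟨ ℤₚ.+-inverseʳ (∑ (suc d) G) ⟩
  0ℤ ∎
  where
  open ≡-Reasoning
  instance
    q≢0 : ℕ.NonZero q
    q≢0 = prime⇒nonZero pq

    d≢0 : ℕ.NonZero d
    d≢0 = ℕ.nonTrivial⇒nonZero d

  -- A length that is a multiple of `q` gives `∑-multiples` whole blocks. Lengthening the range
  -- costs nothing, as no `k` above `d` divides `d`.
  N : ℕ
  N = suc d ℕ.* q

  d<N : suc d ≤ N
  d<N = ℕₚ.m≤m*n (suc d) q

  -- `G` keeps the terms of `F` with `q` not dividing `k`, one from each pair.
  F G : ℕ → ℤ
  F k = ⟦ k ∣? d ⟧ * μ k
  G k = ⟦ ¬? (q ∣? k) ⟧ * F k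

  F-zero : d < k → F k ≡ 0ℤ
  F-zero {k} d<k = cong (_* μ k) (⟦⟧-false (k ∣? d) λ k∣d → ℕₚ.<⇒≱ d<k (∣⇒≤ k∣d))

  G-zero : ∀ k → d < k → G k ≡ 0ℤ
  G-zero k d<k = trans (cong (⟦ ¬? (q ∣? k) ⟧ *_) (F-zero d<k)) (ℤₚ.*-zeroʳ ⟦ ¬? (q ∣? k) ⟧)

  F-split : ∀ k → F k ≡ G k ℤ.+ ⟦ q ∣? k ⟧ * F k
  F-split k with does (q ∣? k)
  ... | true  = sym (trans (ℤₚ.+-identityˡ _) (ℤₚ.*-identityˡ (F k)))
  ... | false = sym (trans (ℤₚ.+-identityʳ _) (ℤₚ.*-identityˡ (F k)))

  F-*q : ∀ k → F (k ℕ.* q) ≡ - G k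
  F-*q k = case (q ∣? k)
    where
    case : Dec (q ∣ k) → F (k ℕ.* q) ≡ - G k
    -- Here the square of `q` divides `k ℕ.* q`, so both sides vanish.
    case (yes q∣k) = begin
      ⟦ k ℕ.* q ∣? d ⟧ * μ (k ℕ.* q) ≡⟨ cong (⟦ k ℕ.* q ∣? d ⟧ *_) (μ-square pq (*-monoˡ-∣ q q∣k)) ⟩
      ⟦ k ℕ.* q ∣? d ⟧ * 0ℤ          ≡⟨ ℤₚ.*-zeroʳ ⟦ k ℕ.* q ∣? d ⟧ ⟩
      - 0ℤ                           ≡⟨ cong (λ x → - (x * F k)) (⟦⟧-false (¬? (q ∣? k)) (_$ q∣k)) ⟨
      - G k ∎
    -- Here `k ℕ.* q` divides `d` exactly when `k` does, and `μ` changes sign.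
    case (no q∤k) = begin
      ⟦ k ℕ.* q ∣? d ⟧ * μ (k ℕ.* q)
        ≡⟨ cong₂ _*_ (⟦⟧-⇔ (k ℕ.* q ∣? d) (k ∣? d) (mk⇔ (m*n∣⇒m∣ k q) (*-∣-prime pq q∣d q∤k))) (μ-*-prime pq q∤k) ⟩
      ⟦ k ∣? d ⟧ * - μ k             ≡⟨ ℤₚ.neg-distribʳ-* ⟦ k ∣? d ⟧ (μ k) ⟨
      - F k                          ≡⟨ cong -_ (ℤₚ.*-identityˡ (F k)) ⟨
      - (1ℤ * F k)                   ≡⟨ cong (λ x → - (x * F k)) (⟦⟧-true (¬? (q ∣? k)) q∤k) ⟨
      - G k ∎

-- The classical divisor sum of `μ`. For `d` equal to 1, all terms from index 2 on vanish and the
-- first two compute.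
∑∣μ : .{{_ : ℕ.NonZero d}} → d < n → ∑ n (λ k → ⟦ k ∣? d ⟧ * μ k) ≡ ⟦ d ℕ.≟ 1 ⟧
∑∣μ {1}              1<n = ∑-extend 1<n λ k 1<k →
  cong (_* μ k) (⟦⟧-false (k ∣? 1) λ k∣1 → ℕₚ.<⇒≱ 1<k (∣⇒≤ k∣1))
∑∣μ {d@(suc (suc _))} d<n = ∑∣μ≡0 d<n

-- Sums along arithmetic progressions

-- Σ_{j≥0} g(m - j k), indexed by i = m - j k.
stepConvolution : ℕ → (ℕ → ℤ) → ℕ → ℤ
stepConvolution k g m = ∑ (suc m) (λ i → ⟦ k ∣? (m ∸ i) ⟧ * g i)

-- Isolates the term j = 0; what remains is the sum over j ≥ 1.
stepConvolution-last : ∀ k g m →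
  stepConvolution k g m ≡ ∑ m (λ i → ⟦ k ∣? (m ∸ i) ⟧ * g i) ℤ.+ g m
stepConvolution-last k g m = trans (∑-last m _) (cong (λ x → ∑ m (λ i → ⟦ k ∣? (m ∸ i) ⟧ * g i) ℤ.+ x)
  (trans (cong (_* g m) (⟦⟧-true (k ∣? (m ∸ m)) (subst (k ∣_) (sym (ℕₚ.n∸n≡0 m)) (k ∣0)))) (ℤₚ.*-identityˡ (g m))))

stepConvolution-< : ∀ g → m < k → stepConvolution k g m ≡ g m
stepConvolution-< {m} {k} g m<k = trans (stepConvolution-last k g m) (trans
  (cong (ℤ._+ g m) (∑-zero m λ i i<m → cong (_* g i) (⟦⟧-false (k ∣? (m ∸ i)) λ k∣ →
    ℕₚ.<⇒≱ m<k (ℕₚ.≤-trans (∣⇒≤ {{ℕ.>-nonZero (ℕₚ.m<n⇒0<n∸m i<m)}} k∣) (ℕₚ.m∸n≤m m i)))))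
  (ℤₚ.+-identityˡ (g m)))

-- Raising the argument by `k` shifts every j by one and adds a new term j = 0.
stepConvolution-+ : ∀ g .{{_ : ℕ.NonZero k}} → stepConvolution k g (k + m) ≡ stepConvolution k g m ℤ.+ g (k + m)
stepConvolution-+ {k@(suc k′)} {m} g = begin
  stepConvolution k g (k + m)                     ≡⟨ stepConvolution-last k g (k + m) ⟩
  ∑ (k + m) h ℤ.+ g (k + m)                       ≡⟨ cong (λ n → ∑ n h ℤ.+ g (k + m)) (cong suc (ℕₚ.+-comm k′ m)) ⟩
  ∑ (suc m + k′) h ℤ.+ g (k + m)                  ≡⟨ cong (ℤ._+ g (k + m)) (∑-split (suc m) k′ h) ⟩
  ∑ (suc m) h ℤ.+ ∑ k′ (λ i → h (suc m + i)) ℤ.+ g (k + m)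
    ≡⟨ cong (ℤ._+ g (k + m)) (cong₂ ℤ._+_ (∑-cong (suc m) low) (∑-zero k′ high)) ⟩
  stepConvolution k g m ℤ.+ 0ℤ ℤ.+ g (k + m)      ≡⟨ cong (ℤ._+ g (k + m)) (ℤₚ.+-identityʳ (stepConvolution k g m)) ⟩
  stepConvolution k g m ℤ.+ g (k + m) ∎
  where
  open ≡-Reasoning
  h : ℕ → ℤ
  h i = ⟦ k ∣? (k + m ∸ i) ⟧ * g i

  low : ∀ i → i < suc m → h i ≡ ⟦ k ∣? (m ∸ i) ⟧ * g i
  low i (s≤s i≤m) = cong (_* g i) (⟦⟧-⇔ (k ∣? (k + m ∸ i)) (k ∣? (m ∸ i)) (mk⇔
    (λ k∣ → ∣m+n∣m⇒∣n (subst (k ∣_) (ℕₚ.+-∸-assoc k i≤m) k∣) ∣-refl)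
    (λ k∣ → subst (k ∣_) (sym (ℕₚ.+-∸-assoc k i≤m)) (∣m∣n⇒∣m+n ∣-refl k∣))))

  -- These indices lie strictly between `m` and `k + m`, at a distance from `k + m` that is positive
  -- and below `k`.
  high : ∀ i → i < k′ → h (suc m + i) ≡ 0ℤ
  high i i<k′ = cong (_* g (suc m + i)) (⟦⟧-false (k ∣? (k + m ∸ (suc m + i))) λ k∣ →
    ℕₚ.<⇒≱ (s≤s (ℕₚ.m∸n≤m k′ i))
      (∣⇒≤ {{ℕ.>-nonZero (ℕₚ.m<n⇒0<n∸m i<k′)}} (subst (k ∣_) gap k∣)))
    where
    gap : k + m ∸ (suc m + i) ≡ k′ ∸ i
    gap = trans (cong (_∸ (m + i)) (ℕₚ.+-comm k′ m)) (ℕₚ.[m+n]∸[m+o]≡n∸o m k′ i)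

-- The values below `k` and the recurrence in steps of `k` determine `f`, by strong induction.
stepConvolution-unique : ∀ k .{{_ : ℕ.NonZero k}} {f g : ℕ → ℤ} →
  (∀ {m} → m < k → f m ≡ g m) → (∀ {m} → f (k + m) ≡ f m ℤ.+ g (k + m)) →
  ∀ m → f m ≡ stepConvolution k g m
stepConvolution-unique k {f} {g} f-< f-+ = <-rec _ step
  where
  step : ∀ m → (∀ {i} → i < m → f i ≡ stepConvolution k g i) → f m ≡ stepConvolution k g m
  step m rec with m ℕ.<? k
  ... | yes m<k = trans (f-< m<k) (sym (stepConvolution-< g m<k))
  ... | no m≮k = subst (λ m → f m ≡ stepConvolution k g m) (ℕₚ.m+[n∸m]≡n k≤m) (begin
    f (k + (m ∸ k))                                         ≡⟨ f-+ ⟩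
    f (m ∸ k) ℤ.+ g (k + (m ∸ k))                           ≡⟨ cong (ℤ._+ g (k + (m ∸ k))) (rec (ℕₚ.∸-monoʳ-< (ℕ.>-nonZero⁻¹ k) k≤m)) ⟩
    stepConvolution k g (m ∸ k) ℤ.+ g (k + (m ∸ k))         ≡⟨ stepConvolution-+ g ⟨
    stepConvolution k g (k + (m ∸ k)) ∎)
    where
    open ≡-Reasoning
    k≤m = ℕₚ.≮⇒≥ m≮k

-- Möbius sums over divisors at least 3

⟦2∣suc⟧ : ∀ a → ⟦ 2 ∣? suc a ⟧ ≡ 1ℤ - ⟦ 2 ∣? a ⟧
⟦2∣suc⟧ zero    = refl
⟦2∣suc⟧ (suc a) = begin
  ⟦ 2 ∣? 2 + a ⟧          ≡⟨ ⟦⟧-⇔ (2 ∣? 2 + a) (2 ∣? a) (mk⇔ (λ 2∣ → ∣m+n∣m⇒∣n 2∣ ∣-refl) (∣m∣n⇒∣m+n ∣-refl)) ⟩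
  ⟦ 2 ∣? a ⟧              ≡⟨ lemma ⟦ 2 ∣? a ⟧ ⟩
  1ℤ - (1ℤ - ⟦ 2 ∣? a ⟧)  ≡⟨ cong (λ x → 1ℤ - x) (⟦2∣suc⟧ a) ⟨
  1ℤ - ⟦ 2 ∣? suc a ⟧ ∎
  where
  open ≡-Reasoning
  lemma : ∀ x → x ≡ 1ℤ - (1ℤ - x)
  lemma = solve-∀

∑∣μ-from3 : .{{_ : ℕ.NonZero d}} → d < 3 + n →
  ∑ n (λ j → ⟦ 3 + j ∣? d ⟧ * μ (3 + j)) ≡ ⟦ d ℕ.≟ 1 ⟧ - 1ℤ ℤ.+ ⟦ 2 ∣? d ⟧
∑∣μ-from3 {d} {n} d<3+n = begin
  E                                                                  ≡⟨ lemma ⟦ 0 ∣? d ⟧ ⟦ 2 ∣? d ⟧ E ⟩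
  -- The terms k = 0, 1, 2 of the full divisor sum are written out with `μ` equal to 0, 1 and -1
  -- there.
  ⟦ 0 ∣? d ⟧ * 0ℤ ℤ.+ (1ℤ * 1ℤ ℤ.+ (⟦ 2 ∣? d ⟧ * -1ℤ ℤ.+ E)) - 1ℤ ℤ.+ ⟦ 2 ∣? d ⟧
    ≡⟨ cong (λ x → ⟦ 0 ∣? d ⟧ * 0ℤ ℤ.+ (x * 1ℤ ℤ.+ (⟦ 2 ∣? d ⟧ * -1ℤ ℤ.+ E)) - 1ℤ ℤ.+ ⟦ 2 ∣? d ⟧) (⟦⟧-true (1 ∣? d) (1∣ d)) ⟨
  ∑ (3 + n) (λ k → ⟦ k ∣? d ⟧ * μ k) - 1ℤ ℤ.+ ⟦ 2 ∣? d ⟧             ≡⟨ cong (λ x → x - 1ℤ ℤ.+ ⟦ 2 ∣? d ⟧) (∑∣μ d<3+n) ⟩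
  ⟦ d ℕ.≟ 1 ⟧ - 1ℤ ℤ.+ ⟦ 2 ∣? d ⟧ ∎
  where
  open ≡-Reasoning
  E = ∑ n (λ j → ⟦ 3 + j ∣? d ⟧ * μ (3 + j))
  lemma : ∀ a b e → e ≡ a * 0ℤ ℤ.+ (1ℤ * 1ℤ ℤ.+ (b * -1ℤ ℤ.+ e)) - 1ℤ ℤ.+ b
  lemma = solve-∀

-- The bracket for d = 1 computes to 0 at `3 + a`, and adding 3 swaps parity.
∑∣μ-from3-≥3 : ∀ a n → a ≤ n → ∑ (suc n) (λ j → ⟦ 3 + j ∣? (3 + a) ⟧ * μ (3 + j)) ≡ - ⟦ 2 ∣? a ⟧
∑∣μ-from3-≥3 a n a≤n = begin
  ∑ (suc n) (λ j → ⟦ 3 + j ∣? (3 + a) ⟧ * μ (3 + j))  ≡⟨ ∑∣μ-from3 (s<s (s<s (s<s (s≤s a≤n)))) ⟩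
  -1ℤ ℤ.+ ⟦ 2 ∣? 3 + a ⟧                              ≡⟨ cong (λ x → -1ℤ ℤ.+ x) parity ⟩
  -1ℤ ℤ.+ (1ℤ - (1ℤ - (1ℤ - ⟦ 2 ∣? a ⟧)))             ≡⟨ lemma ⟦ 2 ∣? a ⟧ ⟩
  - ⟦ 2 ∣? a ⟧ ∎
  where
  open ≡-Reasoning
  parity : ⟦ 2 ∣? 3 + a ⟧ ≡ 1ℤ - (1ℤ - (1ℤ - ⟦ 2 ∣? a ⟧))
  parity = trans (⟦2∣suc⟧ (2 + a)) (cong (λ x → 1ℤ - x)
    (trans (⟦2∣suc⟧ (1 + a)) (cong (λ x → 1ℤ - x) (⟦2∣suc⟧ a))))

  lemma : ∀ b → -1ℤ ℤ.+ (1ℤ - (1ℤ - (1ℤ - b))) ≡ - b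
  lemma = solve-∀

-- Partition counts as sums

∇-defn : ∀ f x → ∇ f x ≡ f x - f (x - 1ℤ)
∇-defn f x = begin
  1ℤ * f (x - 0ℤ) ℤ.+ (-1ℤ * f (x - 1ℤ) ℤ.+ 0ℤ) ≡⟨ cong (λ y → 1ℤ * f y ℤ.+ (-1ℤ * f (x - 1ℤ) ℤ.+ 0ℤ)) (ℤₚ.+-identityʳ x) ⟩
  1ℤ * f x ℤ.+ (-1ℤ * f (x - 1ℤ) ℤ.+ 0ℤ)        ≡⟨ lemma (f x) (f (x - 1ℤ)) ⟩
  f x - f (x - 1ℤ) ∎
  where
  open ≡-Reasoning
  lemma : ∀ a b → 1ℤ * a ℤ.+ (-1ℤ * b ℤ.+ 0ℤ) ≡ a - b
  lemma = solve-∀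

p-partitionsFrom : ∀ n → p (+ n) ≡ + #partitionsFrom 1 n
p-partitionsFrom n = cong (λ xss → + length xss) (sym (partitionsFrom-1 n))

#partitionsFrom-2 : ∀ n → + #partitionsFrom 2 n ≡ p (+ n) - p (+ n - 1ℤ)
-- `p` vanishes at -1, and the partitions of 0 are the same for the bounds 1 and 2.
#partitionsFrom-2 zero    = cong +_ (trans (sym (#partitionsFrom-< z<s)) (cong length (partitionsFrom-1 0)))
#partitionsFrom-2 (suc n) = begin
  + #partitionsFrom 2 (suc n)
    ≡⟨ lemma (+ #partitionsFrom 1 n) (+ #partitionsFrom 2 (suc n)) ⟩
  + #partitionsFrom 1 n ℤ.+ + #partitionsFrom 2 (suc n) - + #partitionsFrom 1 n
    ≡⟨ cong (λ x → + x - + #partitionsFrom 1 n) (#partitionsFrom-+ ℕₚ.≤-refl) ⟨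
  + #partitionsFrom 1 (suc n) - + #partitionsFrom 1 n
    ≡⟨ cong₂ _-_ (p-partitionsFrom (suc n)) (p-partitionsFrom n) ⟨
  p (+ suc n) - p (+ n) ∎
  where
  open ≡-Reasoning
  lemma : ∀ a b → b ≡ a ℤ.+ b - a
  lemma = solve-∀

-- Here j counts the parts equal to `r`; deleting them leaves parts at least `suc r`.
#partitionsFrom-convolution : ∀ r .{{_ : ℕ.NonZero r}} m →
  + #partitionsFrom r m ≡ stepConvolution r (λ i → + #partitionsFrom (suc r) i) m
#partitionsFrom-convolution r = stepConvolution-unique r
  (λ m<r → cong +_ (#partitionsFrom-< m<r))
  (cong +_ (#partitionsFrom-+ (ℕ.>-nonZero⁻¹ r)))

-- `S` itself lacks the term j = 0. Adding the partition count of `m` supplies it, so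
-- `stepConvolution-unique` applies; that term is then cancelled.
S-sum : ∀ r k .{{_ : ℕ.NonZero k}} → r ≤ k → ∀ m →
  + S r m k ≡ ∑ m (λ i → ⟦ k ∣? (m ∸ i) ⟧ * + #partitionsFrom r i)
S-sum r k r≤k m = ∙-cancelʳ (P m) _ _ (trans
  (stepConvolution-unique k {λ m → + S r m k ℤ.+ P m}
    (λ m<k → trans (cong (λ s → + s ℤ.+ P _) (S-< m<k)) (ℤₚ.+-identityˡ (P _)))
    (λ {m} → cong (λ x → x ℤ.+ P (k + m)) (cong +_ (trans (S-+ (ℕ.>-nonZero⁻¹ k) r≤k) (ℕₚ.+-comm _ (S r m k)))))
    m)
  (stepConvolution-last k P m))
  where
  P : ℕ → ℤ
  P i = + #partitionsFrom r i

-- Evaluation of the double sum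

∑Sμ : ∀ n → ∑ (suc n) (λ j → + S 3 (3 + n) (3 + j) * μ (3 + j)) ≡ - (+ #partitionsFrom 2 n)
∑Sμ n = begin
  ∑ (suc n) (λ j → + S 3 N (3 + j) * μ (3 + j))
    ≡⟨ ∑-cong (suc n) (λ j _ → expand j) ⟩
  ∑ (suc n) (λ j → ∑ N (term j))
    ≡⟨ ∑-comm (suc n) N term ⟩
  ∑ N (λ i → ∑ (suc n) (λ j → term j i))
    ≡⟨ ∑-cong N (λ i _ → collect i) ⟩
  ∑ N (λ i → P i * E (N ∸ i))
    -- The range splits where `N ∸ i` drops below 3: the last two indices give divisor arguments 2
    -- and 1.
    ≡⟨ cong (λ l → ∑ l (λ i → P i * E (N ∸ i))) (ℕₚ.+-comm 2 (suc n)) ⟩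
  ∑ (suc n + 2) (λ i → P i * E (N ∸ i))
    ≡⟨ ∑-split (suc n) 2 (λ i → P i * E (N ∸ i)) ⟩
  ∑ (suc n) (λ i → P i * E (N ∸ i)) ℤ.+ ∑ 2 (λ i → P (suc n + i) * E (N ∸ (suc n + i)))
    ≡⟨ cong₂ ℤ._+_ (∑-cong (suc n) low) (∑-zero 2 high) ⟩
  ∑ (suc n) (λ i → - (⟦ 2 ∣? (n ∸ i) ⟧ * P i)) ℤ.+ 0ℤ
    ≡⟨ ℤₚ.+-identityʳ _ ⟩
  ∑ (suc n) (λ i → - (⟦ 2 ∣? (n ∸ i) ⟧ * P i))
    ≡⟨ neg-∑ (suc n) (λ i → ⟦ 2 ∣? (n ∸ i) ⟧ * P i) ⟩
  - stepConvolution 2 P n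
    ≡⟨ cong -_ (#partitionsFrom-convolution 2 n) ⟨
  - (+ #partitionsFrom 2 n) ∎
  where
  open ≡-Reasoning
  N : ℕ
  N = 3 + n

  P E : ℕ → ℤ
  P i = + #partitionsFrom 3 i
  -- The sum of `μ` over divisors of `d` from 3 on; the cutoff at `N` loses nothing for positive
  -- `d ≤ N`.
  E d = ∑ (suc n) (λ j → ⟦ 3 + j ∣? d ⟧ * μ (3 + j))

  term : ℕ → ℕ → ℤ
  term j i = μ (3 + j) * (⟦ 3 + j ∣? (N ∸ i) ⟧ * P i)

  expand : ∀ j → + S 3 N (3 + j) * μ (3 + j) ≡ ∑ N (term j)
  expand j = begin
    + S 3 N (3 + j) * μ (3 + j)                               ≡⟨ ℤₚ.*-comm (+ S 3 N (3 + j)) (μ (3 + j)) ⟩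
    μ (3 + j) * + S 3 N (3 + j)                               ≡⟨ cong (μ (3 + j) *_) (S-sum 3 (3 + j) (ℕₚ.m≤m+n 3 j) N) ⟩
    μ (3 + j) * ∑ N (λ i → ⟦ 3 + j ∣? (N ∸ i) ⟧ * P i)        ≡⟨ *-distribˡ-∑ N (μ (3 + j)) (λ i → ⟦ 3 + j ∣? (N ∸ i) ⟧ * P i) ⟩
    ∑ N (term j) ∎

  rotate : ∀ a b c → a * (b * c) ≡ c * (b * a)
  rotate = solve-∀

  collect : ∀ i → ∑ (suc n) (λ j → term j i) ≡ P i * E (N ∸ i)
  collect i = trans
    (∑-cong (suc n) (λ j _ → rotate (μ (3 + j)) ⟦ 3 + j ∣? (N ∸ i) ⟧ (P i)))
    (sym (*-distribˡ-∑ (suc n) (P i) (λ j → ⟦ 3 + j ∣? (N ∸ i) ⟧ * μ (3 + j))))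

  low : ∀ i → i < suc n → P i * E (N ∸ i) ≡ - (⟦ 2 ∣? (n ∸ i) ⟧ * P i)
  low i (s≤s i≤n) = begin
    P i * E (N ∸ i)              ≡⟨ cong (λ d → P i * E d) (ℕₚ.+-∸-assoc 3 i≤n) ⟩
    P i * E (3 + (n ∸ i))        ≡⟨ cong (P i *_) (∑∣μ-from3-≥3 (n ∸ i) n (ℕₚ.m∸n≤m n i)) ⟩
    P i * - ⟦ 2 ∣? (n ∸ i) ⟧     ≡⟨ lemma (P i) ⟦ 2 ∣? (n ∸ i) ⟧ ⟩
    - (⟦ 2 ∣? (n ∸ i) ⟧ * P i)   ∎
    where
    lemma : ∀ a b → a * - b ≡ - (b * a)
    lemma = solve-∀

  gap : ∀ i → N ∸ (suc n + i) ≡ 2 ∸ i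
  gap i = trans (cong (_∸ (n + i)) (ℕₚ.+-comm 2 n)) (ℕₚ.[m+n]∸[m+o]≡n∸o n 2 i)

  high : ∀ i → i < 2 → P (suc n + i) * E (N ∸ (suc n + i)) ≡ 0ℤ
  high i i<2 = trans (cong (P (suc n + i) *_) (trans (cong E (gap i)) (E≡0 i i<2))) (ℤₚ.*-zeroʳ (P (suc n + i)))
    where
    E≡0 : ∀ i → i < 2 → E (2 ∸ i) ≡ 0ℤ
    -- The closed form computes to 0 - 1 + 1 at argument 2, and to 1 - 1 + 0 at argument 1.
    E≡0 0 _ = ∑∣μ-from3 {n = suc n} (s<s (s<s z<s))
    E≡0 1 _ = ∑∣μ-from3 {n = suc n} (s<s z<s)
    E≡0 (suc (suc _)) (s≤s (s≤s ()))

∑Sμ-from3 : ∀ n → ∑[ k ≔ 3 ⋯ n + 3 ] (+ S 3 (n + 3) k * μ k) ≡ - (+ #partitionsFrom 2 n)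
-- With 3 in front, the number of summands `suc b ∸ a` reduces to `suc n`.
∑Sμ-from3 n rewrite ℕₚ.+-comm n 3 =
  trans (∑-foldr (suc n) (λ i → + S 3 (3 + n) (3 + i) * μ (3 + i)) (λ i → i)) (∑Sμ n)

corollary1p5 : (n : ℕ) →
    (+ length (filter (λ λs → 1 ∉? λs) (partitions n)) ≡ ∇ p (+ n))
    × (∇ p (+ n) ≡ p (+ n) - p (+ n - 1ℤ))
    × (∇ p (+ n) ≡ - (∑[ k ≔ 3 ⋯ n + 3 ] (+ S 3 (n + 3) k * μ k)))
corollary1p5 n =
    trans (cong +_ (filter-1∉ n)) #partitionsFrom-2≡∇p
  , ∇-defn p (+ n)
  , trans (sym #partitionsFrom-2≡∇p)
      (trans (sym (ℤₚ.neg-involutive _)) (cong -_ (sym (∑Sμ-from3 n))))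
  where
  #partitionsFrom-2≡∇p : + #partitionsFrom 2 n ≡ ∇ p (+ n)
  #partitionsFrom-2≡∇p = trans (#partitionsFrom-2 n) (sym (∇-defn p (+ n)))
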